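{- Let $L$ be an oriented non-split alternating link and let $\overline A_B$ and $\overline A_W$ be the weighted adjacency matrices of its consolidated Tait graphs $G_B^*$ and $G_W^*$, respectively. Then $$CWR_4(L)=\left(\Phi_4(\overline A_B),\Phi_4(\overline A_W)\right),$$ where for a symmetric zero-diagonal matrix $M$ $$\Phi_4(M)=\frac18\left[\operatorname{tr}(M^4)-2\left\|M^{\circ2}\mathbf{1}\right\|_2^2+\operatorname{tr}\left((M^{\circ2})^2\right)\right].$$ Equivalently, if $M=(m_{ij})$, then $$\Phi_4(M)=\frac18\left[\operatorname{tr}(M^4)-2\sum_i\Bigl(\sum_jm_{ij}^2\Bigr)^2+\sum_{i,j}m_{ij}^4\right].$$
   Context: $M^{\circ2}=M\circ M$ is the entrywise (Hadamard) square, $\mathbf{1}$ is the all-ones column vector, and for a column vector $y$ with entries in $\mathbb{Z}[w,r]$, $\|y\|_2^2:=y^{\mathsf T}y=\sum_iy_i^2$. Tait graphs and $CWR$. Let $D$ be a reduced (no nugatory crossings) alternating diagram of an oriented non-split alternating link $L$. The regions of $D$ are checkerboard coloured black and white, so that regions sharing an edge have opposite colours; which class is called black is fixed once and for all by a local rule depending on the over/under pattern at crossings, the same rule for all diagrams (the statement holds for either choice of rule). The Tait graph $G_B$ has one vertex for each black region and one edge for each crossing, joining the black regions meeting at that crossing; $G_W$ is defined in the same way from white regions. Each edge $e$ gets weight $\operatorname{wg}(e)=w$ if the crossing is positive and $r$ if it is negative, where $w,r$ are commuting indeterminates. The consolidated Tait graph $G_B^*$ is the weighted simple graph obtained from $G_B$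 by replacing all parallel edges joining the same pair of vertices by a single edge whose weight is the product of their weights; $G_W^*$ is obtained from $G_W$ likewise. For $i>2$, $CB_i(w,r)=\sum_C\prod_{e\in E(C)}\operatorname{wg}(e)$, summed over all unoriented simple cycles $C$ of length $i$ in $G_B^*$; $CW_i$ is defined analogously from $G_W^*$; and $CWR_i=(CB_i,CW_i)$. It is a known theorem that $CWR_i$ does not depend on the chosen reduced alternating diagram $D$ of $L$; $CWR_i(L)$ denotes the common value. The weighted adjacency matrix of a simple loopless weighted graph has $(i,j)$ entry equal to the weight of the edge $v_iv_j$ if it exists, and $0$ otherwise. -}

module Defs where

open import Algebra.Bundles using (CommutativeRing)
open import Data.Bool.Base using (if_then_else_)
open import Data.Empty using (⊥)
open import Data.Fin.Base using (Fin)
import Data.Fin.Properties as Fin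
open import Data.Integer.Base as ℤ using (ℤ)
import Data.Integer.Properties as ℤ
open import Data.List.Base as List
  using (List; []; _∷_; [_]; _++_; length; map; concatMap; filter; foldr; allFin;
         cartesianProductWith; deduplicate)
open import Data.List.Membership.Propositional using (_∈_; mapWith∈; lose)
open import Data.List.Membership.Propositional.Properties using (∈-concatMap⁺)
open import Data.List.Properties using (filter-≐)
open import Data.List.Relation.Binary.Permutation.Propositional using (_↭_)
open import Data.List.Relation.Binary.Permutation.Propositional.Properties using (∈-resp-↭)
open import Data.List.Relation.Unary.All as All using (All; []; _∷_)
open import Data.List.Relation.Unary.Any as Any using (Any; here; there; any?)
open import Data.List.Relation.Unary.Unique.Propositional using (Unique)
open import Data.Nat.Base as ℕ using (ℕ; zero; suc)
import Data.Nat.Properties as ℕ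
open import Data.Product.Base using (Σ; ∃-syntax; _×_; _,_; proj₁; proj₂; uncurry)
open import Data.Rational.Base as ℚ using (ℚ)
import Data.Rational.Properties as ℚ
open import Data.Sign.Base as Sign using (Sign; opposite)
open import Data.Sum.Base as Sum using (_⊎_; inj₁; inj₂)
open import Data.Vec.Base as Vec using (Vec; []; _∷_; _∷ʳ_)
import Data.Vec.Properties as Vec
import Data.Vec.Relation.Unary.All as VecAll
import Data.Vec.Relation.Unary.AllPairs as VecPairs
import Data.Vec.Relation.Unary.Unique.Propositional as VecUnique
open import Function.Base using (_∘_; _on_)
open import Function.Bundles using (Inverse)
open import Level using (0ℓ; _⊔_)
open import Relation.Binary.Bundles using (Setoid)
open import Relation.Binary.Core using (Rel)
open import Relation.Binary.Construct.Closure.Equivalence as Eq using (EqClosure)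
open import Relation.Binary.Construct.Closure.ReflexiveTransitive using (Star)
import Relation.Binary.Construct.On as On
open import Relation.Binary.Definitions using (Decidable; Irreflexive; Symmetric)
open import Relation.Binary.Structures using (IsEquivalence)
open import Relation.Binary.PropositionalEquality as ≡ using (_≡_; _≢_; refl)
open import Relation.Nullary.Decidable using (Dec; does; _×-dec_; _⊎-dec_; ¬?)
open import Relation.Nullary.Negation using (¬_)

------------------------------------------------------------------------
-- Polynomials in two commuting indeterminates

infixl 6 _⊕_
infixl 7 _⊗_
infix  8 ⊝_

data Term {k} (K : Set k) : Set k where
  con     : K → Term K
  w r     : Term K
  _⊕_ _⊗_ : Term K → Term K → Term K
  ⊝_      : Term K → Term K

mapTerm : ∀ {k l} {K : Set k} {L : Set l} → (K → L) → Term K → Term L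
mapTerm f (con a) = con (f a)
mapTerm f w       = w
mapTerm f r       = r
mapTerm f (p ⊕ q) = mapTerm f p ⊕ mapTerm f q
mapTerm f (p ⊗ q) = mapTerm f p ⊗ mapTerm f q
mapTerm f (⊝ p)   = ⊝ mapTerm f p

-- K[w,r] is the free commutative K-algebra on two generators: terms modulo
-- the least congruence that satisfies the commutative ring axioms and makes
-- con : K → K[w,r] a ring homomorphism.
module _ {c ℓ} (K : CommutativeRing c ℓ) where
  private module K = CommutativeRing K

  infix 4 _≋_

  data _≋_ : Rel (Term K.Carrier) (c ⊔ ℓ) where
    ≋-refl      : ∀ {p} → p ≋ p
    ≋-sym       : ∀ {p q} → p ≋ q → q ≋ p
    ≋-trans     : ∀ {p q s} → p ≋ q → q ≋ s → p ≋ s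
    ⊕-cong      : ∀ {p p′ q q′} → p ≋ p′ → q ≋ q′ → p ⊕ q ≋ p′ ⊕ q′
    ⊗-cong      : ∀ {p p′ q q′} → p ≋ p′ → q ≋ q′ → p ⊗ q ≋ p′ ⊗ q′
    ⊝-cong      : ∀ {p p′} → p ≋ p′ → ⊝ p ≋ ⊝ p′
    ⊕-assoc     : ∀ p q s → (p ⊕ q) ⊕ s ≋ p ⊕ (q ⊕ s)
    ⊕-comm      : ∀ p q → p ⊕ q ≋ q ⊕ p
    ⊕-identityˡ : ∀ p → con K.0# ⊕ p ≋ p
    ⊝-inverseˡ  : ∀ p → ⊝ p ⊕ p ≋ con K.0#
    ⊗-assoc     : ∀ p q s → (p ⊗ q) ⊗ s ≋ p ⊗ (q ⊗ s)
    ⊗-comm      : ∀ p q → p ⊗ q ≋ q ⊗ p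
    ⊗-identityˡ : ∀ p → con K.1# ⊗ p ≋ p
    distribˡ    : ∀ p q s → p ⊗ (q ⊕ s) ≋ p ⊗ q ⊕ p ⊗ s
    con-cong    : ∀ {a b} → a K.≈ b → con a ≋ con b
    con-⊕       : ∀ a b → con (a K.+ b) ≋ con a ⊕ con b
    con-⊗       : ∀ a b → con (a K.* b) ≋ con a ⊗ con b
    con-⊝       : ∀ a → con (K.- a) ≋ ⊝ con a

  polynomialRing : CommutativeRing c (c ⊔ ℓ)
  polynomialRing = record
    { Carrier = Term K.Carrier
    ; _≈_ = _≋_
    ; _+_ = _⊕_
    ; _*_ = _⊗_
    ; -_  = ⊝_
    ; 0#  = con K.0#
    ; 1#  = con K.1#
    ; isCommutativeRing = record
      { isRing = record
        { +-isAbelianGroup = record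
          { isGroup = record
            { isMonoid = record
              { isSemigroup = record
                { isMagma = record
                  { isEquivalence = isEquivalence
                  ; ∙-cong = ⊕-cong
                  }
                ; assoc = ⊕-assoc
                }
              ; identity = ⊕-identityˡ , λ p → ≋-trans (⊕-comm p _) (⊕-identityˡ p)
              }
            ; inverse = ⊝-inverseˡ , λ p → ≋-trans (⊕-comm p _) (⊝-inverseˡ p)
            ; ⁻¹-cong = ⊝-cong
            }
          ; comm = ⊕-comm
          }
        ; *-cong = ⊗-cong
        ; *-assoc = ⊗-assoc
        ; *-identity = ⊗-identityˡ , λ p → ≋-trans (⊗-comm p _) (⊗-identityˡ p)
        ; distrib = distribˡ , λ p q s →
            ≋-trans (⊗-comm _ p)
              (≋-trans (distribˡ p q s) (⊕-cong (⊗-comm p q) (⊗-comm p s)))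
        }
      ; *-comm = ⊗-comm
      }
    }
    where
    isEquivalence : IsEquivalence _≋_
    isEquivalence = record { refl = ≋-refl ; sym = ≋-sym ; trans = ≋-trans }

ℤ[w,r] ℚ[w,r] : CommutativeRing 0ℓ 0ℓ
ℤ[w,r] = polynomialRing ℤ.+-*-commutativeRing
ℚ[w,r] = polynomialRing ℚ.+-*-commutativeRing

module ℤ[w,r] = CommutativeRing ℤ[w,r]
module ℚ[w,r] = CommutativeRing ℚ[w,r]

-- The inclusion ℤ[w,r] ⊆ ℚ[w,r].
ι : ℤ[w,r].Carrier → ℚ[w,r].Carrier
ι = mapTerm (ℚ._/ 1)

sumᴸ productᴸ : List ℤ[w,r].Carrier → ℤ[w,r].Carrier
sumᴸ     = foldr ℤ[w,r]._+_ ℤ[w,r].0#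
productᴸ = foldr ℤ[w,r]._*_ ℤ[w,r].1#

------------------------------------------------------------------------
-- Matrices over ℤ[w,r] and the functional Φ₄

open import Algebra.Properties.CommutativeMonoid.Sum ℤ[w,r].+-commutativeMonoid
  using (sum-syntax)

Column : ℕ → Set
Column n = Fin n → ℤ[w,r].Carrier

Matrix : ℕ → Set
Matrix n = Fin n → Fin n → ℤ[w,r].Carrier

module _ {n : ℕ} where
  open ℤ[w,r] using (_≈_; _*_; 0#; 1#)

  SymmetricMatrix ZeroDiagonal : Matrix n → Set
  SymmetricMatrix M = ∀ i j → M i j ≈ M j i
  ZeroDiagonal    M = ∀ i → M i i ≈ 0#

  infixl 7 _·_ _·ᵛ_
  infix  8 _^_ _^∘2

  _·_ : Matrix n → Matrix n → Matrix n
  (M · N) i j = ∑[ k < n ] (M i k * N k j)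

  identity : Matrix n
  identity i j = if does (i Fin.≟ j) then 1# else 0#

  _^_ : Matrix n → ℕ → Matrix n
  M ^ zero  = identity
  M ^ suc k = M · (M ^ k)

  _^∘2 : Matrix n → Matrix n
  (M ^∘2) i j = M i j * M i j

  _·ᵛ_ : Matrix n → Column n → Column n
  (M ·ᵛ y) i = ∑[ j < n ] (M i j * y j)

  𝟏 : Column n
  𝟏 _ = 1#

  ‖_‖² : Column n → ℤ[w,r].Carrier
  ‖ y ‖² = ∑[ i < n ] (y i * y i)

  tr : Matrix n → ℤ[w,r].Carrier
  tr M = ∑[ i < n ] M i i

⅛·_ : ℤ[w,r].Carrier → ℚ[w,r].Carrier
⅛· p = con (ℤ.+ 1 ℚ./ 8) ℚ[w,r].* ι p

two : ℤ[w,r].Carrier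
two = con (ℤ.+ 2)

module _ {n : ℕ} (M : Matrix n) where
  open ℤ[w,r] using (_+_; _-_; _*_)

  Φ₄ : ℚ[w,r].Carrier
  Φ₄ = ⅛· (tr (M ^ 4) - two * ‖ M ^∘2 ·ᵛ 𝟏 ‖² + tr ((M ^∘2) ^ 2))

  rowSquares : Column n
  rowSquares i = ∑[ j < n ] (M i j * M i j)

  Φ₄-entries : ℚ[w,r].Carrier
  Φ₄-entries = ⅛· (tr (M ^ 4) - two * (∑[ i < n ] (rowSquares i * rowSquares i))
                     + ∑[ i < n ] (∑[ j < n ] (M i j * M i j * M i j * M i j)))

------------------------------------------------------------------------
-- Weighted graphs on the vertex set Fin n

record WeightedEdge (n : ℕ) : Set where
  field
    end₁ end₂ : Fin n
    weight    : ℤ[w,r].Carrier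

Multigraph : ℕ → Set
Multigraph n = List (WeightedEdge n)

module _ {n : ℕ} where
  open WeightedEdge

  Joins : Fin n → Fin n → WeightedEdge n → Set
  Joins i j e = (end₁ e ≡ i × end₂ e ≡ j) ⊎ (end₁ e ≡ j × end₂ e ≡ i)

  joins? : ∀ i j e → Dec (Joins i j e)
  joins? i j e = (end₁ e Fin.≟ i ×-dec end₂ e Fin.≟ j)
           ⊎-dec (end₁ e Fin.≟ j ×-dec end₂ e Fin.≟ i)

  Loopless : Multigraph n → Set
  Loopless = All (λ e → end₁ e ≢ end₂ e)

-- The value of weight i j is meaningful only when Adj i j holds.
record WeightedGraph (n : ℕ) : Set₁ where
  field
    Adj        : Rel (Fin n) 0ℓ
    adj?       : Decidable Adj
    sym        : Symmetric Adj
    irrefl     : Irreflexive _≡_ Adj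
    weight     : Fin n → Fin n → ℤ[w,r].Carrier
    weight-sym : ∀ i j → weight i j ℤ[w,r].≈ weight j i

module _ {n : ℕ} (G : Multigraph n) (loopless : Loopless G) where
  open WeightedEdge

  consolidate : WeightedGraph n
  consolidate = record
    { Adj        = λ i j → Any (Joins i j) G
    ; adj?       = λ i j → any? (joins? i j) G
    ; sym        = Any.map Sum.swap
    ; irrefl     = λ { refl → no-loop loopless }
    ; weight     = λ i j → productᴸ (map weight (filter (joins? i j) G))
    ; weight-sym = λ i j → ℤ[w,r].reflexive (≡.cong (productᴸ ∘ map weight)
                     (filter-≐ (joins? i j) (joins? j i) (Sum.swap , Sum.swap) G))
    }
    where
    no-loop : ∀ {i H} → Loopless H → Any (Joins i i) H → ⊥
    no-loop (e≢ ∷ _)  (here (inj₁ (refl , p))) = e≢ (≡.sym p)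
    no-loop (e≢ ∷ _)  (here (inj₂ (refl , p))) = e≢ (≡.sym p)
    no-loop (_  ∷ es) (there p)                = no-loop es p

-- A simple cycle of length i > 2 is traversed by a closed walk through i
-- distinct vertices, given by the vector of these vertices.
module _ {A : Set} where

  rotate : ∀ {i} → Vec A i → Vec A i
  rotate []       = []
  rotate (v ∷ vs) = vs ∷ʳ v

  steps : ∀ {i} → Vec A i → Vec (A × A) i
  steps vs = Vec.zip vs (rotate vs)

  traversals : ∀ {i} → Vec A i → List (Vec A i)
  traversals {i} vs = List.iterate rotate vs i ++ List.iterate rotate (Vec.reverse vs) i

SameCycle : ∀ {n i} → Rel (Vec (Fin n) i) 0ℓ
SameCycle us vs = vs ∈ traversals us

sameCycle? : ∀ {n i} → Decidable (SameCycle {n} {i})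
sameCycle? us vs = any? (Vec.≡-dec Fin._≟_ vs) (traversals us)

allVecs : ∀ n i → List (Vec (Fin n) i)
allVecs n zero    = [ [] ]
allVecs n (suc i) = cartesianProductWith _∷_ (allFin n) (allVecs n i)

module _ {n : ℕ} (G : WeightedGraph n) where
  open WeightedGraph G

  adjacencyMatrix : Matrix n
  adjacencyMatrix i j = if does (adj? i j) then weight i j else ℤ[w,r].0#

  IsCycle : ∀ {i} → Vec (Fin n) i → Set
  IsCycle vs = VecUnique.Unique vs × VecAll.All (uncurry Adj) (steps vs)

  isCycle? : ∀ {i} (vs : Vec (Fin n) i) → Dec (IsCycle vs)
  isCycle? vs = VecPairs.allPairs? (λ u v → ¬? (u Fin.≟ v)) vs
          ×-dec VecAll.all? (uncurry adj?) (steps vs)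

  -- Vectors that are traversals of each other represent the same unoriented
  -- cycle; one vector is kept for each cycle.
  unorientedCycles : ∀ i → List (Vec (Fin n) i)
  unorientedCycles i = deduplicate sameCycle? (filter isCycle? (allVecs n i))

  cycleWeight : ∀ {i} → Vec (Fin n) i → ℤ[w,r].Carrier
  cycleWeight vs = productᴸ (map (uncurry weight) (Vec.toList (steps vs)))

  cyclePolynomial : ℕ → ℤ[w,r].Carrier
  cyclePolynomial i = sumᴸ (map cycleWeight (unorientedCycles i))

CWR : ∀ {m n} → ℕ → WeightedGraph m → WeightedGraph n → ℤ[w,r].Carrier × ℤ[w,r].Carrier
CWR i G*B G*W = cyclePolynomial G*B i , cyclePolynomial G*W i

------------------------------------------------------------------------
-- Oriented link diagrams on the sphere, as planar diagram codes

Arc : Set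
Arc = ℕ

record Crossing : Set where
  constructor X
  field
    sign                           : Sign
    underIn underOut overIn overOut : Arc

open Crossing

-- A pass vertex is a marked point at which the strand runs from the first
-- arc into the second. It makes crossingless components representable
-- (pass a a is a circle) and the Reidemeister moves local.
data Vertex : Set where
  crossing : Crossing → Vertex
  pass     : Arc → Arc → Vertex

Code : Set
Code = List Vertex

insᵛ outsᵛ : Vertex → List Arc
insᵛ  (crossing k) = underIn k ∷ overIn k ∷ []
insᵛ  (pass a b)   = [ a ]
outsᵛ (crossing k) = underOut k ∷ overOut k ∷ []
outsᵛ (pass a b)   = [ b ]

crossingsᵛ : Vertex → List Crossing
crossingsᵛ (crossing k) = [ k ]
crossingsᵛ (pass a b)   = []

arcs outs : Code → List Arc
arcs = concatMap insᵛ
outs = concatMap outsᵛ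

crossings : Code → List Crossing
crossings = concatMap crossingsᵛ

-- Every arc leaves exactly one vertex and enters exactly one vertex.
WellFormed : Code → Set
WellFormed D = Unique (arcs D) × outs D ↭ arcs D

data Hand : Set where
  left right : Hand

flip : Hand → Hand
flip left  = right
flip right = left

-- The left and right side of an arc are taken with respect to its direction.
Side : Set
Side = Arc × Hand

-- The pairs of arc sides that meet in a corner at a vertex. Looking along the
-- under strand, the over strand runs from left to right at a positive
-- crossing and from right to left at a negative one.
corners : Vertex → List (Side × Side)
corners (crossing (X Sign.+ ui uo oi oo)) =
  ((ui , left)  , (oi , right)) ∷
  ((ui , right) , (oo , right)) ∷
  ((uo , right) , (oo , left))  ∷
  ((uo , left)  , (oi , left))  ∷ []
corners (crossing (X Sign.- ui uo oi oo)) =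
  ((ui , left)  , (oo , left))  ∷
  ((ui , right) , (oi , left))  ∷
  ((uo , right) , (oi , right)) ∷
  ((uo , left)  , (oo , right)) ∷ []
corners (pass a b) =
  ((a , left) , (b , left)) ∷ ((a , right) , (b , right)) ∷ []

SameRegion : Code → Rel Side 0ℓ
SameRegion D = EqClosure (λ s t → (s , t) ∈ concatMap corners D)

SameComponent : Code → Rel Arc 0ℓ
SameComponent D = EqClosure (λ a b → Any (λ v → a ∈ insᵛ v ++ outsᵛ v × b ∈ insᵛ v ++ outsᵛ v) D)

-- The classes of these setoids are the boundary walks of the complementary
-- regions (for a connected diagram, the regions themselves) and the connected
-- components of the underlying 4-valent graph.
regions components : Code → Setoid 0ℓ 0ℓ
regions D = record
  { Carrier       = Σ Side (λ s → proj₁ s ∈ arcs D)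
  ; _≈_           = SameRegion D on proj₁
  ; isEquivalence = On.isEquivalence proj₁ (Eq.isEquivalence _)
  }
components D = record
  { Carrier       = Σ Arc (_∈ arcs D)
  ; _≈_           = SameComponent D on proj₁
  ; isEquivalence = On.isEquivalence proj₁ (Eq.isEquivalence _)
  }

Numbering : Setoid 0ℓ 0ℓ → ℕ → Set
Numbering S n = Inverse S (≡.setoid (Fin n))

-- Euler's formula V - E + F = 2C. Each crossing has two outgoing arcs and
-- each pass vertex has one, so E - V is the number of crossings.
Planar : Code → Set
Planar D = ∃[ f ] ∃[ k ] Numbering (regions D) f × Numbering (components D) k
             × f ≡ length (crossings D) ℕ.+ 2 ℕ.* k

record Diagram : Set where
  field
    code       : Code
    wellFormed : WellFormed code
    planar     : Planar code

open Diagram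

Connected : Diagram → Set
Connected D = Numbering (components (code D)) 1

------------------------------------------------------------------------
-- Oriented links

rename : (Arc → Arc) → Vertex → Vertex
rename f (crossing (X s ui uo oi oo)) = crossing (X s (f ui) (f uo) (f oi) (f oo))
rename f (pass a b)                   = pass (f a) (f b)

_↦_ : Arc → Arc → Arc → Arc
(b ↦ a) x = if does (x ℕ.≟ b) then a else x

-- Three consecutive arcs of a strand that runs through two crossings; the
-- earlier crossing has sign + and the later one has sign - in `at`.
record Strand : Set where
  constructor strand
  field
    before between after : Arc

at : Sign → Strand → Arc × Arc
at Sign.+ (strand x y z) = x , y
at Sign.- (strand x y z) = y , z

meet : Sign → (under over : Arc × Arc) → Vertex
meet s (ui , uo) (oi , oo) = crossing (X s ui uo oi oo)

-- The triangle formed by a top strand t, a middle strand m and a bottom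
-- strand b. The signs α, β, γ are positive when, respectively, t meets m
-- before b, m meets t before b, and b meets t before m. If t, m, b have
-- directions T, M, B and the crossings are P = t∩m, Q = t∩b, R = m∩b, then
-- Q - P, R - P and R - Q are αT, βM and γB up to positive factors, so that
-- (R - P) = (Q - P) + (R - Q) determines all signs from that of t∩b, the
-- sign of an over/under pair being that of (over direction) × (under direction).
triangle : (s α β γ : Sign) (t m b : Strand) → Code
triangle s α β γ t m b =
  meet (β Sign.* γ Sign.* s) (at β m)            (at α t)            ∷
  meet s                     (at γ b)            (at (opposite α) t) ∷
  meet (α Sign.* β Sign.* s) (at (opposite γ) b) (at (opposite β) m) ∷ []

infix 4 _⇝_ _≅_

-- The moves are used only between diagrams, i.e. when source and target are
-- well formed and planar. Well-formedness forces f to be injective on the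
-- arcs in `relabel`, and the inner arcs of the Reidemeister moves to be new;
-- planarity forces the two strands in R2 to border a common region, unless
-- they lie in different components of the diagram.
data _⇝_ : Rel Code 0ℓ where
  permute : ∀ {D D′} → D ↭ D′ → D ⇝ D′
  relabel : ∀ f {D} → D ⇝ map (rename f) D
  erase   : ∀ {a b D} → a ≢ b → pass a b ∷ D ⇝ map (rename (b ↦ a)) D
  R1-under : ∀ s x l y {D} →
    crossing (X s x l l y) ∷ D ⇝ pass x y ∷ D
  R1-over : ∀ s x l y {D} →
    crossing (X s l y x l) ∷ D ⇝ pass x y ∷ D
  R2-parallel : ∀ s x y z p q o {D} →
    crossing (X s x y p q) ∷ crossing (X (opposite s) y z q o) ∷ D
      ⇝ pass x z ∷ pass p o ∷ D
  R2-antiparallel : ∀ s x y z p q o {D} →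
    crossing (X s y z p q) ∷ crossing (X (opposite s) x y q o) ∷ D
      ⇝ pass x z ∷ pass p o ∷ D
  R3 : ∀ s α β γ t m b {D} →
    triangle s α β γ t m b ++ D
      ⇝ triangle s (opposite α) (opposite β) (opposite γ) t m b ++ D

-- By Reidemeister's theorem, isotopy of the oriented links presented by two
-- diagrams.
_≅_ : Rel Diagram 0ℓ
_≅_ = EqClosure (λ D D′ → code D ⇝ code D′)

-- An oriented link is given by one of its diagrams, links being equal when
-- they are related by _≅_.
Link : Set
Link = Diagram

_IsDiagramOf_ : Diagram → Link → Set
D IsDiagramOf L = D ≅ L

NonSplit : Link → Set
NonSplit L = ∀ D → D IsDiagramOf L → Connected D

------------------------------------------------------------------------
-- Reduced alternating diagrams

Leads : Code → Rel Arc 0ℓ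
Leads D = Star (λ a b → pass a b ∈ D)

Alternating : Diagram → Set
Alternating D = ∀ {k k′} → k ∈ crossings (code D) → k′ ∈ crossings (code D) →
  ¬ Leads (code D) (underOut k) (underIn k′) × ¬ Leads (code D) (overOut k) (overIn k′)

AlternatingLink : Link → Set
AlternatingLink L = ∃[ D ] D IsDiagramOf L × Alternating D

-- (underIn k , h) and (underOut k , flip h) lie in opposite corners at k. If
-- these belong to one region, a circle through that region meets the diagram
-- only at k.
Nugatory : Diagram → Crossing → Set
Nugatory D k = ∃[ h ] SameRegion (code D) (underIn k , h) (underOut k , flip h)

Reduced : Diagram → Set
Reduced D = ∀ {k} → k ∈ crossings (code D) → ¬ Nugatory D k

------------------------------------------------------------------------
-- Checkerboard colourings and Tait graphs

data Colour : Set where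
  black white : Colour

-- The two local rules are given by a hand: under `left`, the black corners at
-- a crossing are those swept out by turning the over strand counterclockwise
-- until it meets the under strand; under `right`, clockwise. For either
-- crossing sign these are the corner to the given hand of the incoming under
-- arc and the corner opposite to it.
Rule : Set
Rule = Hand

cornerHand : Rule → Colour → Hand
cornerHand ρ black = ρ
cornerHand ρ white = flip ρ

-- The values of colour on arcs that do not occur in D are irrelevant.
record Checkerboard (ρ : Rule) (D : Diagram) : Set where
  field
    colour       : Side → Colour
    on-regions   : ∀ {s t} → SameRegion (code D) s t → colour s ≡ colour t
    alternates   : ∀ {a} → a ∈ arcs (code D) → colour (a , left) ≢ colour (a , right)
    at-crossings : ∀ {k} → k ∈ crossings (code D) → ∀ κ →
                   colour (underIn k , cornerHand ρ κ) ≡ κ ×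
                   colour (underOut k , flip (cornerHand ρ κ)) ≡ κ

module _ {ρ : Rule} {D : Diagram} (χ : Checkerboard ρ D) where
  open Checkerboard χ

  colouredRegions : Colour → Setoid 0ℓ 0ℓ
  colouredRegions κ = record
    { Carrier       = Σ Side (λ s → proj₁ s ∈ arcs (code D) × colour s ≡ κ)
    ; _≈_           = SameRegion (code D) on proj₁
    ; isEquivalence = On.isEquivalence proj₁ (Eq.isEquivalence _)
    }

crossingWeight : Sign → ℤ[w,r].Carrier
crossingWeight Sign.+ = w
crossingWeight Sign.- = r

private
  crossing∈ : ∀ {k} (D : Code) → k ∈ crossings D → crossing k ∈ D
  crossing∈ (crossing _ ∷ D) (here refl) = here refl
  crossing∈ (crossing _ ∷ D) (there k∈)  = there (crossing∈ D k∈)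
  crossing∈ (pass _ _   ∷ D) k∈          = there (crossing∈ D k∈)

  underIn∈ : ∀ (D : Diagram) {k} → k ∈ crossings (code D) → underIn k ∈ arcs (code D)
  underIn∈ D k∈ = ∈-concatMap⁺ insᵛ (lose (crossing∈ (code D) k∈) (here refl))

  underOut∈ : ∀ (D : Diagram) {k} → k ∈ crossings (code D) → underOut k ∈ arcs (code D)
  underOut∈ D k∈ = ∈-resp-↭ (proj₂ (wellFormed D))
    (∈-concatMap⁺ outsᵛ (lose (crossing∈ (code D) k∈) (here refl)))

  all-mapWith∈ : ∀ {A B : Set} {P : B → Set} (xs : List A) {f : ∀ {x} → x ∈ xs → B} →
                 (∀ {x} (x∈ : x ∈ xs) → P (f x∈)) → All P (mapWith∈ xs f)
  all-mapWith∈ []       p = []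
  all-mapWith∈ (x ∷ xs) p = p (here refl) ∷ all-mapWith∈ xs (p ∘ there)

module _ {ρ : Rule} {D : Diagram} (χ : Checkerboard ρ D) (κ : Colour)
         {n : ℕ} (ν : Numbering (colouredRegions χ κ) n) where
  open Checkerboard χ

  private
    module ν = Inverse ν
    h = cornerHand ρ κ

    corner₁ corner₂ : ∀ {k} → k ∈ crossings (code D) → Setoid.Carrier (colouredRegions χ κ)
    corner₁ {k} k∈ = (underIn k , h) , underIn∈ D k∈ , proj₁ (at-crossings k∈ κ)
    corner₂ {k} k∈ = (underOut k , flip h) , underOut∈ D k∈ , proj₂ (at-crossings k∈ κ)

  taitGraph : Multigraph n
  taitGraph = mapWith∈ (crossings (code D)) λ {k} k∈ → record
    { end₁   = ν.to (corner₁ k∈)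
    ; end₂   = ν.to (corner₂ k∈)
    ; weight = crossingWeight (sign k)
    }

  taitGraph-loopless : Reduced D → Loopless taitGraph
  taitGraph-loopless reduced = all-mapWith∈ (crossings (code D)) λ {k} k∈ same →
    reduced k∈ (h , Setoid.trans (colouredRegions χ κ)
      {corner₁ k∈} {ν.from (ν.to (corner₁ k∈))} {corner₂ k∈}
      (Setoid.sym (colouredRegions χ κ) {ν.from (ν.to (corner₁ k∈))} {corner₁ k∈}
        (ν.strictlyInverseʳ (corner₁ k∈)))
      (ν.inverseʳ {corner₂ k∈} same))

  consolidatedTaitGraph : Reduced D → WeightedGraph n
  consolidatedTaitGraph reduced = consolidate taitGraph (taitGraph-loopless reduced)

{-# OPTIONS --safe #-}

-- Every 4-cycle has exactly 8 traversals, so 8 CWR₄ sums the weights of all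
-- closed walks a-b-c-d-a with distinct vertices. The trace tr(M⁴) sums over all
-- closed walks of length 4; as adjacent vertices differ, those to be removed
-- are the walks with c = a or with d = b. Either kind contributes
-- ∑ᵢ(∑ⱼ mᵢⱼ²)², and the walks of both kinds contribute ∑ᵢⱼ mᵢⱼ⁴.

module Submission where

open import Defs
open import Data.Nat.Base using (ℕ; zero; suc)
open import Data.Product.Base using (_×_; _,_; proj₁; proj₂)

open import Data.Bool.Base using (if_then_else_)
open import Data.Fin.Base using (Fin; zero; suc)
open import Data.Fin.Patterns using (0F; 1F; 2F; 3F)
import Data.Fin.Properties as Fin
import Data.Integer.Base as ℤ
import Data.Integer.Properties as ℤ
open import Data.List.Base as List
  using (List; []; _∷_; _++_; length; map; concatMap; filter; allFin; tabulate;
         cartesianProductWith)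
import Data.List.Membership.DecPropositional as DecMembership
open import Data.List.Membership.Propositional using (_∈_; find; lose)
open import Data.List.Membership.Propositional.Properties
  using (∈-map⁺; ∈-map⁻; ∈-allFin; ∈-cartesianProductWith⁺; ∈-concatMap⁺; ∈-concatMap⁻;
         ∈-filter⁺; ∈-filter⁻; ∈-deduplicate⁻)
open import Data.List.Membership.Propositional.Properties.WithK using (unique∧set⇒bag)
open import Data.List.Properties using (map-++; map-∘; map-tabulate)
open import Data.List.Relation.Binary.BagAndSetEquality using (∼bag⇒↭)
open import Data.List.Relation.Binary.Permutation.Propositional
  using (_↭_; prep; swap; trans; refl)
open import Data.List.Relation.Unary.All as All using (All; []; _∷_; all?)
import Data.List.Relation.Unary.All.Properties as All
open import Data.List.Relation.Unary.AllPairs as AllPairs using ([]; _∷_)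
import Data.List.Relation.Unary.AllPairs.Properties as AllPairs
open import Data.List.Relation.Unary.Any using (here)
import Data.List.Relation.Unary.Any.Properties as Any
import Data.List.Relation.Unary.Unique.DecPropositional as DecUnique
import Data.List.Relation.Unary.Unique.DecSetoid.Properties as DecSetoidUnique
open import Data.List.Relation.Unary.Unique.Propositional using (Unique)
import Data.List.Relation.Unary.Unique.Propositional.Properties as Unique
import Data.Rational.Base as ℚ
import Data.Rational.Properties as ℚ
import Data.Rational.Unnormalised.Base as ℚᵘ
import Data.Rational.Unnormalised.Properties as ℚᵘ
open import Data.Vec.Base as Vec using (Vec; []; _∷_)
import Data.Vec.Properties as Vec
open import Data.Vec.Relation.Unary.All using ([]; _∷_)
open import Data.Vec.Relation.Unary.AllPairs using ([]; _∷_)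
import Data.Vec.Relation.Unary.Unique.Propositional as VecUnique
import Data.Vec.Relation.Unary.Unique.Propositional.Properties as VecUnique
open import Function.Base using (_∘_)
open import Function.Bundles using (mk⇔)
open import Relation.Binary.Bundles using (DecSetoid)
open import Relation.Binary.PropositionalEquality as ≡ using (_≡_; _≢_; refl; ≢-sym)
open import Relation.Nullary.Decidable using (Dec; yes; no; does; from-yes; dec-true; dec-false)
open import Relation.Nullary.Negation using (¬_; contradiction)

open ℤ[w,r] using (_≈_; _+_; _*_; _-_; -_; 0#; 1#)
open import Algebra.Properties.Semiring.Sum ℤ[w,r].semiring
  using (sum; sum-syntax; sum-cong-≋; sum-replicate-zero; ∑-comm; ∑-distrib-+;
         *-distribˡ-sum; *-distribʳ-sum)
open import Algebra.Solver.CommutativeMonoid ℤ[w,r].*-commutativeMonoid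
  using (solve; _⊜_; id) renaming (_⊕_ to _⊙_)
open import Relation.Binary.Reasoning.Setoid ℤ[w,r].setoid

-- The inclusion of coefficients

-- `ℚ._/_` normalises by a gcd that does not evaluate on a variable numerator. The equation is
-- therefore checked between unnormalised fractions with denominator 1 and carried back by
-- injectivity of `toℚᵘ`.
/1-+ : ∀ a b → (a ℤ.+ b) ℚ./ 1 ≡ (a ℚ./ 1) ℚ.+ (b ℚ./ 1)
/1-+ a b = ℚ.toℚᵘ-injective (ℚᵘ.≃-trans (ℚ.toℚᵘ-fromℚᵘ (ℚᵘ.mkℚᵘ (a ℤ.+ b) 0))
  (ℚᵘ.≃-trans (ℚᵘ.*≡* (≡.cong (ℤ._* ℤ.+ 1)
      (≡.sym (≡.cong₂ ℤ._+_ (ℤ.*-identityʳ a) (ℤ.*-identityʳ b)))))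
  (ℚᵘ.≃-sym (ℚᵘ.≃-trans (ℚ.toℚᵘ-homo-+ (a ℚ./ 1) (b ℚ./ 1))
    (ℚᵘ.+-cong (ℚ.toℚᵘ-fromℚᵘ (ℚᵘ.mkℚᵘ a 0)) (ℚ.toℚᵘ-fromℚᵘ (ℚᵘ.mkℚᵘ b 0)))))))

/1-* : ∀ a b → (a ℤ.* b) ℚ./ 1 ≡ (a ℚ./ 1) ℚ.* (b ℚ./ 1)
/1-* a b = ℚ.toℚᵘ-injective (ℚᵘ.≃-trans (ℚ.toℚᵘ-fromℚᵘ (ℚᵘ.mkℚᵘ (a ℤ.* b) 0))
  (ℚᵘ.≃-sym (ℚᵘ.≃-trans (ℚ.toℚᵘ-homo-* (a ℚ./ 1) (b ℚ./ 1))
    (ℚᵘ.*-cong (ℚ.toℚᵘ-fromℚᵘ (ℚᵘ.mkℚᵘ a 0)) (ℚ.toℚᵘ-fromℚᵘ (ℚᵘ.mkℚᵘ b 0))))))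

/1-neg : ∀ a → (ℤ.- a) ℚ./ 1 ≡ ℚ.- (a ℚ./ 1)
/1-neg a = ℚ.toℚᵘ-injective (ℚᵘ.≃-trans (ℚ.toℚᵘ-fromℚᵘ (ℚᵘ.mkℚᵘ (ℤ.- a) 0))
  (ℚᵘ.≃-sym (ℚᵘ.≃-trans (ℚ.toℚᵘ-homo‿- (a ℚ./ 1))
    (ℚᵘ.-‿cong (ℚ.toℚᵘ-fromℚᵘ (ℚᵘ.mkℚᵘ a 0))))))

-- Induction on the derivation of `p ≈ q`: each ring axiom is sent to the same axiom over the
-- rationals, and only the three rules for constants use that `ℚ._/ 1` is a homomorphism.
ι-cong : ∀ {p q} → p ≈ q → ι p ℚ[w,r].≈ ι q
ι-cong ≋-refl            = ≋-refl
ι-cong (≋-sym e)         = ≋-sym (ι-cong e)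
ι-cong (≋-trans e f)     = ≋-trans (ι-cong e) (ι-cong f)
ι-cong (⊕-cong e f)      = ⊕-cong (ι-cong e) (ι-cong f)
ι-cong (⊗-cong e f)      = ⊗-cong (ι-cong e) (ι-cong f)
ι-cong (⊝-cong e)        = ⊝-cong (ι-cong e)
ι-cong (⊕-assoc p q s)   = ⊕-assoc _ _ _
ι-cong (⊕-comm p q)      = ⊕-comm _ _
ι-cong (⊕-identityˡ p)   = ⊕-identityˡ _
ι-cong (⊝-inverseˡ p)    = ⊝-inverseˡ _
ι-cong (⊗-assoc p q s)   = ⊗-assoc _ _ _
ι-cong (⊗-comm p q)      = ⊗-comm _ _
ι-cong (⊗-identityˡ p)   = ⊗-identityˡ _
ι-cong (distribˡ p q s)  = distribˡ _ _ _
ι-cong (con-cong a≡b)    = con-cong (≡.cong (ℚ._/ 1) a≡b)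
ι-cong (con-⊕ a b)       = ≋-trans (con-cong (/1-+ a b)) (con-⊕ _ _)
ι-cong (con-⊗ a b)       = ≋-trans (con-cong (/1-* a b)) (con-⊗ _ _)
ι-cong (con-⊝ a)         = ≋-trans (con-cong (/1-neg a)) (con-⊝ _)

⅛·-cong : ∀ {p q} → p ≈ q → ⅛· p ℚ[w,r].≈ ⅛· q
⅛·-cong e = ⊗-cong ≋-refl (ι-cong e)

eight : ℤ[w,r].Carrier
eight = con (ℤ.+ 8)

⅛·eight* : ∀ p → ⅛· (eight * p) ℚ[w,r].≈ ι p
⅛·eight* p = ≋-trans (≋-sym (⊗-assoc _ _ _))
  -- The closed product of 1/8 and 8/1 evaluates to 1, so `⊗-identityˡ` applies to it directly.
  (≋-trans (⊗-cong (≋-sym (con-⊗ (ℤ.+ 1 ℚ./ 8) (ℤ.+ 8 ℚ./ 1))) ≋-refl) (⊗-identityˡ _))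

-- Conditional terms and sums

infix 5 _when_

-- Testing `does p` makes the entries of `adjacencyMatrix` and of `identity` conditional terms by
-- definition.
_when_ : ∀ {P : Set} → ℤ[w,r].Carrier → Dec P → ℤ[w,r].Carrier
x when p = if does p then x else 0#

when-true : ∀ {P : Set} (p : Dec P) {x} → P → x when p ≈ x
when-true p h rewrite dec-true p h = ≋-refl

when-false : ∀ {P : Set} (p : Dec P) {x} → ¬ P → x when p ≈ 0#
when-false p ¬h rewrite dec-false p ¬h = ≋-refl

-- The termwise form of the count, with `x` a closed walk, `y` a cycle term and `P`, `Q` the two
-- coincidences of vertices. The overlap stands on the left so that no subtraction occurs before the
-- terms are summed.
inclusion-exclusion : ∀ {P Q : Set} (p : Dec P) (q : Dec Q) {x y} →
  (P → y ≈ 0#) → (Q → y ≈ 0#) → (¬ P → ¬ Q → x ≈ y) →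
  x + ((x when p) when q) ≈ y + ((x when p) + (x when q))
inclusion-exclusion (yes h) (yes _) y≈0 _ _ = ≋-sym (≋-trans (⊕-cong (y≈0 h) ≋-refl) (⊕-identityˡ _))
inclusion-exclusion (yes h) (no _)  y≈0 _ _ = ≋-sym (≋-trans (⊕-cong (y≈0 h) ≋-refl) (⊕-identityˡ _))
inclusion-exclusion (no _)  (yes h) {x} _ y≈0 _ = begin
  x + 0#         ≈⟨ ⊕-comm _ _ ⟩
  0# + x         ≈⟨ ⊕-identityˡ _ ⟨
  0# + (0# + x)  ≈⟨ ⊕-cong (y≈0 h) ≋-refl ⟨
  _ + (0# + x)   ∎
inclusion-exclusion (no ¬p) (no ¬q) _ _ x≈y = ⊕-cong (x≈y ¬p ¬q) (≋-sym (⊕-identityˡ _))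

∑-zero : ∀ n → ∑[ i < n ] 0# ≈ 0#
∑-zero n = sum-replicate-zero n

∑-when : ∀ {n} {P : Set} (p : Dec P) (f : Fin n → ℤ[w,r].Carrier) →
         ∑[ i < n ] (f i when p) ≈ (sum f when p)
∑-when     (yes _) f = ≋-refl
∑-when {n} (no _)  f = ∑-zero n

∑-select : ∀ {n} (j : Fin n) (f : Fin n → ℤ[w,r].Carrier) →
           ∑[ i < n ] (f i when (i Fin.≟ j)) ≈ f j
∑-select {suc n} zero    f = ≋-trans (⊕-cong ≋-refl (∑-zero n)) (ℤ[w,r].+-identityʳ _)
-- The term at `zero` evaluates to `0#`, and `does (suc i Fin.≟ suc j)` evaluates to
-- `does (i Fin.≟ j)`, so the remaining sum has the form required by the recursive call.
∑-select {suc n} (suc j) f = ≋-trans (⊕-identityˡ _) (∑-select j (f ∘ suc))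

-- Sums over lists

sumᴸ-++ : ∀ xs ys → sumᴸ (xs ++ ys) ≈ sumᴸ xs + sumᴸ ys
sumᴸ-++ []       ys = ≋-sym (⊕-identityˡ _)
sumᴸ-++ (x ∷ xs) ys = ≋-trans (⊕-cong ≋-refl (sumᴸ-++ xs ys)) (≋-sym (⊕-assoc _ _ _))

module _ {A : Set} where

  sumᴸ-↭ : ∀ (f : A → ℤ[w,r].Carrier) {xs ys} → xs ↭ ys → sumᴸ (map f xs) ≈ sumᴸ (map f ys)
  sumᴸ-↭ f refl         = ≋-refl
  sumᴸ-↭ f (prep x p)   = ⊕-cong ≋-refl (sumᴸ-↭ f p)
  sumᴸ-↭ f (swap x y p) = ≋-trans (≋-sym (⊕-assoc _ _ _))
    (≋-trans (⊕-cong (⊕-comm _ _) (sumᴸ-↭ f p)) (⊕-assoc _ _ _))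
  sumᴸ-↭ f (trans p q)  = ≋-trans (sumᴸ-↭ f p) (sumᴸ-↭ f q)

  sumᴸ-filter : ∀ {P : A → Set} (P? : ∀ x → Dec (P x)) f xs →
    sumᴸ (map f (filter P? xs)) ≈ sumᴸ (map (λ x → f x when P? x) xs)
  sumᴸ-filter P? f []       = ≋-refl
  sumᴸ-filter P? f (x ∷ xs) with P? x
  ... | yes _ = ⊕-cong ≋-refl (sumᴸ-filter P? f xs)
  ... | no  _ = ≋-trans (sumᴸ-filter P? f xs) (≋-sym (⊕-identityˡ _))

  sumᴸ-constant : ∀ (f : A → ℤ[w,r].Carrier) {y xs} → All (λ x → f x ≈ y) xs →
    sumᴸ (map f xs) ≈ con (ℤ.+ length xs) * y
  sumᴸ-constant f []       = ≋-sym (ℤ[w,r].zeroˡ _)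
  sumᴸ-constant f {y} {x ∷ xs} (e ∷ es) = begin
    f x + sumᴸ (map f xs)               ≈⟨ ⊕-cong e (sumᴸ-constant f es) ⟩
    y + con (ℤ.+ length xs) * y         ≈⟨ ⊕-cong (⊗-identityˡ y) ≋-refl ⟨
    1# * y + con (ℤ.+ length xs) * y    ≈⟨ ℤ[w,r].distribʳ _ _ _ ⟨
    (1# + con (ℤ.+ length xs)) * y      ≈⟨ ⊗-cong (con-⊕ (ℤ.+ 1) (ℤ.+ length xs)) ≋-refl ⟨
    con (ℤ.+ length (x ∷ xs)) * y       ∎

  -- Intended for blocks `g y` that are the traversals of a cycle `y`, with `c` equal to `eight` and
  -- `h` equal to `f`.
  sumᴸ-concatMap : ∀ {B : Set} (f : A → ℤ[w,r].Carrier) (g : B → List A) c h ys →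
    All (λ y → sumᴸ (map f (g y)) ≈ c * h y) ys →
    sumᴸ (map f (concatMap g ys)) ≈ c * sumᴸ (map h ys)
  sumᴸ-concatMap f g c h []       []       = ≋-sym (ℤ[w,r].zeroʳ c)
  sumᴸ-concatMap f g c h (y ∷ ys) (e ∷ es) = begin
    sumᴸ (map f (g y ++ concatMap g ys))                ≡⟨ ≡.cong sumᴸ (map-++ f (g y) _) ⟩
    sumᴸ (map f (g y) ++ map f (concatMap g ys))        ≈⟨ sumᴸ-++ (map f (g y)) _ ⟩
    sumᴸ (map f (g y)) + sumᴸ (map f (concatMap g ys))  ≈⟨ ⊕-cong e (sumᴸ-concatMap f g c h ys es) ⟩
    c * h y + c * sumᴸ (map h ys)                       ≈⟨ distribˡ _ _ _ ⟨
    c * (h y + sumᴸ (map h ys))                         ∎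

sumᴸ-tabulate : ∀ {n} (f : Fin n → ℤ[w,r].Carrier) → sumᴸ (tabulate f) ≡ sum f
sumᴸ-tabulate {zero}  f = refl
sumᴸ-tabulate {suc n} f = ≡.cong (f zero +_) (sumᴸ-tabulate (f ∘ suc))

sumᴸ-allFin : ∀ {n} (f : Fin n → ℤ[w,r].Carrier) → sumᴸ (map f (allFin n)) ≡ sum f
sumᴸ-allFin f = ≡.trans (≡.cong sumᴸ (map-tabulate (λ i → i) f)) (sumᴸ-tabulate f)

sumᴸ-product : ∀ {A B C : Set} (f : C → ℤ[w,r].Carrier) (g : A → B → C) xs ys →
  sumᴸ (map f (cartesianProductWith g xs ys)) ≈ sumᴸ (map (λ x → sumᴸ (map (f ∘ g x) ys)) xs)
sumᴸ-product f g []       ys = ≋-refl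
sumᴸ-product f g (x ∷ xs) ys = begin
  sumᴸ (map f (map (g x) ys ++ cartesianProductWith g xs ys))
    ≡⟨ ≡.cong sumᴸ (map-++ f (map (g x) ys) _) ⟩
  sumᴸ (map f (map (g x) ys) ++ map f (cartesianProductWith g xs ys))
    ≈⟨ sumᴸ-++ (map f (map (g x) ys)) _ ⟩
  sumᴸ (map f (map (g x) ys)) + sumᴸ (map f (cartesianProductWith g xs ys))
    ≈⟨ ⊕-cong (ℤ[w,r].reflexive (≡.cong sumᴸ (≡.sym (map-∘ ys)))) (sumᴸ-product f g xs ys) ⟩
  sumᴸ (map (f ∘ g x) ys) + sumᴸ (map (λ x → sumᴸ (map (f ∘ g x) ys)) xs) ∎

sumᴸ-allVecs : ∀ {n} i (f : Vec (Fin n) (suc i) → ℤ[w,r].Carrier) →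
  sumᴸ (map f (allVecs n (suc i))) ≈ ∑[ a < n ] sumᴸ (map (λ vs → f (a ∷ vs)) (allVecs n i))
sumᴸ-allVecs {n} i f = ≋-trans (sumᴸ-product f _∷_ (allFin n) (allVecs n i))
  (ℤ[w,r].reflexive (sumᴸ-allFin (λ a → sumᴸ (map (λ vs → f (a ∷ vs)) (allVecs n i)))))

-- Fourfold sums over vertices

∑⁴ : ∀ {n} → (Fin n → Fin n → Fin n → Fin n → ℤ[w,r].Carrier) → ℤ[w,r].Carrier
∑⁴ {n} f = ∑[ a < n ] ∑[ b < n ] ∑[ c < n ] ∑[ d < n ] f a b c d

∑⁴-cong : ∀ {n} {f g : Fin n → Fin n → Fin n → Fin n → ℤ[w,r].Carrier} →
          (∀ a b c d → f a b c d ≈ g a b c d) → ∑⁴ f ≈ ∑⁴ g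
∑⁴-cong e = sum-cong-≋ λ a → sum-cong-≋ λ b → sum-cong-≋ λ c → sum-cong-≋ λ d → e a b c d

∑⁴-distrib-+ : ∀ {n} (f g : Fin n → Fin n → Fin n → Fin n → ℤ[w,r].Carrier) →
  ∑⁴ (λ a b c d → f a b c d + g a b c d) ≈ ∑⁴ f + ∑⁴ g
∑⁴-distrib-+ f g =
  ≋-trans (sum-cong-≋ λ a →
    ≋-trans (sum-cong-≋ λ b →
      ≋-trans (sum-cong-≋ λ c → ∑-distrib-+ (f a b c) (g a b c))
              (∑-distrib-+ (λ c → sum (f a b c)) (λ c → sum (g a b c))))
    (∑-distrib-+ (λ b → ∑[ c < _ ] sum (f a b c)) (λ b → ∑[ c < _ ] sum (g a b c))))
  (∑-distrib-+ (λ a → ∑[ b < _ ] ∑[ c < _ ] sum (f a b c)) (λ a → ∑[ b < _ ] ∑[ c < _ ] sum (g a b c)))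

sumᴸ-allVecs⁴ : ∀ {n} (f : Vec (Fin n) 4 → ℤ[w,r].Carrier) →
  sumᴸ (map f (allVecs n 4)) ≈ ∑⁴ (λ a b c d → f (a ∷ b ∷ c ∷ d ∷ []))
sumᴸ-allVecs⁴ f =
  ≋-trans (sumᴸ-allVecs 3 f) (sum-cong-≋ λ a →
  ≋-trans (sumᴸ-allVecs 2 (λ vs → f (a ∷ vs))) (sum-cong-≋ λ b →
  ≋-trans (sumᴸ-allVecs 1 (λ vs → f (a ∷ b ∷ vs))) (sum-cong-≋ λ c →
  ≋-trans (sumᴸ-allVecs 0 (λ vs → f (a ∷ b ∷ c ∷ vs))) (sum-cong-≋ λ d →
  -- `allVecs n 0` is a singleton, so its list sum still ends in `+ 0#`.
  ℤ[w,r].+-identityʳ (f (a ∷ b ∷ c ∷ d ∷ []))))))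

-- Traversals of 4-cycles

iterate⁺ : ∀ {A : Set} {P : A → Set} {f : A → A} → (∀ x → P x → P (f x)) →
           ∀ {x} → P x → ∀ n → All P (List.iterate f x n)
iterate⁺ step px zero    = []
iterate⁺ step px (suc n) = px ∷ iterate⁺ step (step _ px) n

-- All traversals arise by rotating `us` or its reversal, so stability under the two generators
-- suffices. Both being a cycle and having a given weight are propagated in this way.
traversals⁺ : ∀ {A : Set} {i} {P : Vec A i → Set} →
  (∀ vs → P vs → P (rotate vs)) → (∀ vs → P vs → P (Vec.reverse vs)) →
  ∀ {us} → P us → All P (traversals us)
traversals⁺ {i = i} rot rev p = All.++⁺ (iterate⁺ rot p i) (iterate⁺ rot (rev _ p) i)

square : Vec (Fin 4) 4
square = 0F ∷ 1F ∷ 2F ∷ 3F ∷ []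

_≟ⱽ_ : ∀ {n i} (us vs : Vec (Fin n) i) → Dec (us ≡ vs)
_≟ⱽ_ = Vec.≡-dec Fin._≟_

traversals-map : ∀ {A B : Set} (f : A → B) (vs : Vec A 4) →
                 traversals (Vec.map f vs) ≡ map (Vec.map f) (traversals vs)
traversals-map f (_ ∷ _ ∷ _ ∷ _ ∷ []) = refl

-- Every vector of length 4 is a relabelling of the square, so the dihedral group
-- laws need only be checked on the traversals of the square, by evaluation.
traversals-square : ∀ {A : Set} (vs : Vec A 4) →
                    traversals vs ≡ map (Vec.map (Vec.lookup vs)) (traversals square)
traversals-square (_ ∷ _ ∷ _ ∷ _ ∷ []) = refl

map-lookup-square : ∀ {A : Set} (vs : Vec A 4) → Vec.map (Vec.lookup vs) square ≡ vs
map-lookup-square (_ ∷ _ ∷ _ ∷ _ ∷ []) = refl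

-- The traversals of `square` are the eight elements of the dihedral group, written as
-- rearrangements of positions. This is closure under inverses, and `square-transitive` is closure
-- under products.
square-symmetric : All (λ p → square ∈ traversals p) (traversals square)
square-symmetric = from-yes (all? (λ p → square ∈? traversals p) (traversals square))
  where open DecMembership _≟ⱽ_ using (_∈?_)

square-transitive : All (λ p → All (_∈ traversals square) (traversals p)) (traversals square)
square-transitive =
  from-yes (all? (λ p → all? (_∈? traversals square) (traversals p)) (traversals square))
  where open DecMembership _≟ⱽ_ using (_∈?_)

square-unique : Unique (traversals square)
square-unique = from-yes (unique? (traversals square))
  where open DecUnique _≟ⱽ_ using (unique?)

SameCycle-refl : ∀ {n} (us : Vec (Fin n) 4) → SameCycle us us
SameCycle-refl (_ ∷ _ ∷ _ ∷ _ ∷ []) = here refl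

SameCycle-sym : ∀ {n} {us vs : Vec (Fin n) 4} → SameCycle us vs → SameCycle vs us
SameCycle-sym {us = us} us~vs rewrite traversals-square us
  -- Here `vs` is `us` read along a traversal `p` of the square, and `us` is itself the image of
  -- `square`; the claim is the image of `square-symmetric` under `lookup us`.
  with p , p∈ , refl ← ∈-map⁻ (Vec.map (Vec.lookup us)) us~vs =
  ≡.subst₂ _∈_ (map-lookup-square us) (≡.sym (traversals-map (Vec.lookup us) p))
    (∈-map⁺ (Vec.map (Vec.lookup us)) (All.lookup square-symmetric p∈))

SameCycle-trans : ∀ {n} {us vs ws : Vec (Fin n) 4} →
                  SameCycle us vs → SameCycle vs ws → SameCycle us ws
SameCycle-trans {us = us} us~vs vs~ws rewrite traversals-square us
  with p , p∈ , refl ← ∈-map⁻ (Vec.map (Vec.lookup us)) us~vs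
  rewrite traversals-map (Vec.lookup us) p
  with q , q∈ , refl ← ∈-map⁻ (Vec.map (Vec.lookup us)) vs~ws =
  ∈-map⁺ (Vec.map (Vec.lookup us)) (All.lookup (All.lookup square-transitive p∈) q∈)

-- Bundled for the fact that removing duplicates up to an equivalence leaves pairwise inequivalent
-- representatives.
sameCycle-decSetoid : ℕ → DecSetoid _ _
sameCycle-decSetoid n = record
  { Carrier          = Vec (Fin n) 4
  ; _≈_              = SameCycle
  ; isDecEquivalence = record
    { isEquivalence = record
      { refl  = λ {us} → SameCycle-refl us
      ; sym   = SameCycle-sym
      ; trans = SameCycle-trans
      }
    ; _≟_ = sameCycle?
    }
  }

Vec-map-injective : ∀ {A B : Set} {f : A → B} → (∀ {x y} → f x ≡ f y → x ≡ y) →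
                    ∀ {i} {us vs : Vec A i} → Vec.map f us ≡ Vec.map f vs → us ≡ vs
Vec-map-injective inj {us = []}     {[]}     _ = refl
Vec-map-injective inj {us = u ∷ us} {v ∷ vs} e with eq₁ , eq₂ ← Vec.∷-injective e =
  ≡.cong₂ _∷_ (inj eq₁) (Vec-map-injective inj eq₂)

-- Distinct entries make `lookup us` injective, so the eight distinct traversals of the square keep
-- distinct images.
traversals-unique : ∀ {n} {us : Vec (Fin n) 4} → VecUnique.Unique us → Unique (traversals us)
traversals-unique {us = us} us! rewrite traversals-square us =
  Unique.map⁺ (Vec-map-injective (VecUnique.lookup-injective us! _ _)) square-unique

length-traversals : ∀ {A : Set} (vs : Vec A 4) → length (traversals vs) ≡ 8
length-traversals (_ ∷ _ ∷ _ ∷ _ ∷ []) = refl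

∈-allVecs : ∀ {n i} (vs : Vec (Fin n) i) → vs ∈ allVecs n i
∈-allVecs []       = here refl
∈-allVecs (v ∷ vs) = ∈-cartesianProductWith⁺ _∷_ (∈-allFin v) (∈-allVecs vs)

allVecs-unique : ∀ n i → Unique (allVecs n i)
allVecs-unique n zero    = [] ∷ []
allVecs-unique n (suc i) =
  Unique.cartesianProductWith⁺ _∷_ Vec.∷-injective (Unique.allFin⁺ n) (allVecs-unique n i)

-- Eight traversals for each 4-cycle of a graph

module _ {n : ℕ} (G : WeightedGraph n) where
  open WeightedGraph G

  private
    cycles : List (Vec (Fin n) 4)
    cycles = filter (isCycle? G) (allVecs n 4)

    A : Matrix n
    A = adjacencyMatrix G

  IsCycle-rotate : (vs : Vec (Fin n) 4) → IsCycle G vs → IsCycle G (rotate vs)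
  IsCycle-rotate (_ ∷ _ ∷ _ ∷ _ ∷ [])
    ( (ab ∷ ac ∷ ad ∷ []) ∷ (bc ∷ bd ∷ []) ∷ (cd ∷ []) ∷ [] ∷ []
    , (eab ∷ ebc ∷ ecd ∷ eda ∷ [])) =
    ( (bc ∷ bd ∷ ≢-sym ab ∷ []) ∷ (cd ∷ ≢-sym ac ∷ []) ∷ (≢-sym ad ∷ []) ∷ [] ∷ []
    , (ebc ∷ ecd ∷ eda ∷ eab ∷ []))

  IsCycle-reverse : (vs : Vec (Fin n) 4) → IsCycle G vs → IsCycle G (Vec.reverse vs)
  IsCycle-reverse (_ ∷ _ ∷ _ ∷ _ ∷ [])
    ( (ab ∷ ac ∷ ad ∷ []) ∷ (bc ∷ bd ∷ []) ∷ (cd ∷ []) ∷ [] ∷ []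
    , (eab ∷ ebc ∷ ecd ∷ eda ∷ [])) =
    ( (≢-sym cd ∷ ≢-sym bd ∷ ≢-sym ad ∷ []) ∷ (≢-sym bc ∷ ≢-sym ac ∷ []) ∷ (≢-sym ab ∷ []) ∷ [] ∷ []
    -- Reversal also reverses the order of the first three edges, while the closing edge stays last.
    , (sym ecd ∷ sym ebc ∷ sym eab ∷ sym eda ∷ []))

  IsCycle-traversals : {us : Vec (Fin n) 4} → IsCycle G us → All (IsCycle G) (traversals us)
  IsCycle-traversals = traversals⁺ IsCycle-rotate IsCycle-reverse

  cycleWeight-rotate : (vs : Vec (Fin n) 4) → cycleWeight G (rotate vs) ≈ cycleWeight G vs
  cycleWeight-rotate (_ ∷ _ ∷ _ ∷ _ ∷ []) =
    -- `id` stands for the `1#` at the end of `productᴸ`.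
    solve 4 (λ x y z u → y ⊙ (z ⊙ (u ⊙ (x ⊙ id))) ⊜ x ⊙ (y ⊙ (z ⊙ (u ⊙ id)))) ≋-refl _ _ _ _

  cycleWeight-reverse : (vs : Vec (Fin n) 4) → cycleWeight G (Vec.reverse vs) ≈ cycleWeight G vs
  cycleWeight-reverse (a ∷ b ∷ c ∷ d ∷ []) = ≋-trans
    (⊗-cong (weight-sym d c) (⊗-cong (weight-sym c b) (⊗-cong (weight-sym b a) (⊗-cong (weight-sym a d) ≋-refl))))
    (solve 4 (λ x y z u → z ⊙ (y ⊙ (x ⊙ (u ⊙ id))) ⊜ x ⊙ (y ⊙ (z ⊙ (u ⊙ id)))) ≋-refl _ _ _ _)

  cycleWeight-traversals : (us : Vec (Fin n) 4) →
    All (λ vs → cycleWeight G vs ≈ cycleWeight G us) (traversals us)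
  cycleWeight-traversals us = traversals⁺ (λ vs → ≋-trans (cycleWeight-rotate vs))
    (λ vs → ≋-trans (cycleWeight-reverse vs)) ≋-refl

  unorientedCycles-IsCycle : All (IsCycle G) (unorientedCycles G 4)
  unorientedCycles-IsCycle = All.tabulate λ vs∈ →
    proj₂ (∈-filter⁻ (isCycle? G) {xs = allVecs n 4} (∈-deduplicate⁻ sameCycle? cycles vs∈))

  -- Two duplicate-free lists with the same members are permutations of each other. On the left,
  -- each block is duplicate-free because a cycle has distinct vertices, and different blocks are
  -- disjoint because a common traversal would make their representatives equivalent.
  traversals-of-unorientedCycles : concatMap traversals (unorientedCycles G 4) ↭ cycles
  traversals-of-unorientedCycles = ∼bag⇒↭ (unique∧set⇒bag
    (Unique.concat⁺
      (All.map⁺ (All.map (traversals-unique ∘ proj₁) unorientedCycles-IsCycle))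
      (AllPairs.map⁺ (AllPairs.map
        (λ us≁vs {_} (ws∈us , ws∈vs) → us≁vs (SameCycle-trans ws∈us (SameCycle-sym ws∈vs)))
        (DecSetoidUnique.deduplicate-! (sameCycle-decSetoid n) cycles))))
    (Unique.filter⁺ (isCycle? G) (allVecs-unique n 4))
    (mk⇔ to from))
    where
    to : ∀ {vs} → vs ∈ concatMap traversals (unorientedCycles G 4) → vs ∈ cycles
    to vs∈ with us , us∈ , vs∈us ← find (∈-concatMap⁻ traversals {xs = unorientedCycles G 4} vs∈) =
      ∈-filter⁺ (isCycle? G) (∈-allVecs _)
        (All.lookup (IsCycle-traversals (All.lookup unorientedCycles-IsCycle us∈)) vs∈us)

    from : ∀ {vs} → vs ∈ cycles → vs ∈ concatMap traversals (unorientedCycles G 4)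
    -- `vs` may have been dropped in favour of an equivalent vector. Having `vs` as a traversal is
    -- true of `vs` itself and passes along `SameCycle` to the representative that was kept.
    from {vs} vs∈ = ∈-concatMap⁺ traversals (Any.deduplicate⁺ sameCycle?
      (λ us′~us us~vs → SameCycle-trans us′~us us~vs) (lose vs∈ (SameCycle-refl vs)))

  cycleTerm : (a b c d : Fin n) → ℤ[w,r].Carrier
  cycleTerm a b c d = cycleWeight G vs when isCycle? G vs
    where
    vs : Vec (Fin n) 4
    vs = a ∷ b ∷ c ∷ d ∷ []

  eight*cyclePolynomial : eight * cyclePolynomial G 4 ≈ ∑⁴ cycleTerm
  eight*cyclePolynomial = begin
    eight * cyclePolynomial G 4
      -- Each representative is expanded into its eight traversals, all of the same weight.
      ≈⟨ sumᴸ-concatMap (cycleWeight G) traversals eight (cycleWeight G) (unorientedCycles G 4)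
           (All.universal weight-of-traversals _) ⟨
    sumᴸ (map (cycleWeight G) (concatMap traversals (unorientedCycles G 4)))
      ≈⟨ sumᴸ-↭ (cycleWeight G) traversals-of-unorientedCycles ⟩
    sumᴸ (map (cycleWeight G) cycles)
      ≈⟨ sumᴸ-filter (isCycle? G) (cycleWeight G) (allVecs n 4) ⟩
    sumᴸ (map (λ vs → cycleWeight G vs when isCycle? G vs) (allVecs n 4))
      ≈⟨ sumᴸ-allVecs⁴ (λ vs → cycleWeight G vs when isCycle? G vs) ⟩
    ∑⁴ cycleTerm ∎
    where
    weight-of-traversals : ∀ us → sumᴸ (map (cycleWeight G) (traversals us)) ≈ eight * cycleWeight G us
    weight-of-traversals us = ≋-trans (sumᴸ-constant (cycleWeight G) (cycleWeight-traversals us))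
      (⊗-cong (con-cong (≡.cong ℤ.+_ (length-traversals us))) ≋-refl)

  adjacencyMatrix-symmetric : SymmetricMatrix A
  adjacencyMatrix-symmetric i j with adj? i j | adj? j i
  ... | yes _ | yes _ = weight-sym i j
  ... | yes e | no ¬e = contradiction (sym e) ¬e
  ... | no ¬e | yes e = contradiction (sym e) ¬e
  ... | no _  | no _  = ≋-refl

-- Closed walks of length 4

module _ {n : ℕ} (M : Matrix n) where

  closedWalk : (a b c d : Fin n) → ℤ[w,r].Carrier
  closedWalk a b c d = M a b * (M b c * (M c d * M d a))

  -- `_^_` recurses down to `identity`, so each positive power ends in this factor, which has to be
  -- removed from the traces.
  ·-identityʳ : ∀ i j → (M · identity) i j ≈ M i j
  ·-identityʳ i j = ≋-trans (sum-cong-≋ λ k → term (k Fin.≟ j) (M i k)) (∑-select j (M i))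
    where
    term : ∀ {P : Set} (p : Dec P) x → x * (if does p then 1# else 0#) ≈ (x when p)
    term (yes _) x = ℤ[w,r].*-identityʳ x
    term (no _)  x = ℤ[w,r].zeroʳ x

  tr-^4 : tr (M ^ 4) ≈ ∑⁴ closedWalk
  tr-^4 = sum-cong-≋ λ a → sum-cong-≋ λ b → begin
    M a b * (∑[ c < n ] (M b c * (∑[ d < n ] (M c d * (M ^ 1) d a))))
      ≈⟨ *-distribˡ-sum (M a b) (λ c → M b c * (∑[ d < n ] (M c d * (M ^ 1) d a))) ⟩
    ∑[ c < n ] (M a b * (M b c * (∑[ d < n ] (M c d * (M ^ 1) d a))))
      ≈⟨ sum-cong-≋ (λ c → ⊗-cong ≋-refl (*-distribˡ-sum (M b c) (λ d → M c d * (M ^ 1) d a))) ⟩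
    ∑[ c < n ] (M a b * (∑[ d < n ] (M b c * (M c d * (M ^ 1) d a))))
      ≈⟨ sum-cong-≋ (λ c → *-distribˡ-sum (M a b) (λ d → M b c * (M c d * (M ^ 1) d a))) ⟩
    ∑[ c < n ] ∑[ d < n ] (M a b * (M b c * (M c d * (M ^ 1) d a)))
      ≈⟨ sum-cong-≋ {n} (λ c → sum-cong-≋ {n} λ d →
           ⊗-cong ≋-refl (⊗-cong ≋-refl (⊗-cong ≋-refl (·-identityʳ d a)))) ⟩
    ∑[ c < n ] ∑[ d < n ] closedWalk a b c d ∎

  squareOfRowSquares : ℤ[w,r].Carrier
  squareOfRowSquares = ∑[ i < n ] (rowSquares M i * rowSquares M i)

  fourthPowers : ℤ[w,r].Carrier
  fourthPowers = ∑[ i < n ] ∑[ j < n ] (M i j * M i j * M i j * M i j)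

  squareOfRowSquares-expand :
    squareOfRowSquares ≈ ∑[ i < n ] ∑[ j < n ] ∑[ k < n ] ((M i j * M i j) * (M i k * M i k))
  squareOfRowSquares-expand = sum-cong-≋ λ i →
    ≋-trans (*-distribʳ-sum (rowSquares M i) (λ j → M i j * M i j))
            (sum-cong-≋ λ j → *-distribˡ-sum (M i j * M i j) (λ k → M i k * M i k))

  ‖M^∘2·𝟏‖² : ‖ M ^∘2 ·ᵛ 𝟏 ‖² ≈ squareOfRowSquares
  ‖M^∘2·𝟏‖² = sum-cong-≋ λ i → ⊗-cong (row i) (row i)
    where
    row : ∀ i → (M ^∘2 ·ᵛ 𝟏) i ≈ rowSquares M i
    row i = sum-cong-≋ λ j → ℤ[w,r].*-identityʳ (M i j * M i j)

  module _ (symmetric : SymmetricMatrix M) where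

    -- Such a walk goes from `a` to `b` and back, then to `d` and back. By symmetry its weight is a
    -- product of two squares from row `a`.
    closedWalks-c≡a : ∑⁴ (λ a b c d → closedWalk a b c d when (c Fin.≟ a)) ≈ squareOfRowSquares
    closedWalks-c≡a = ≋-trans
      (sum-cong-≋ λ a → sum-cong-≋ λ b → begin
        ∑[ c < n ] ∑[ d < n ] (closedWalk a b c d when (c Fin.≟ a))
          ≈⟨ sum-cong-≋ (λ c → ∑-when (c Fin.≟ a) (closedWalk a b c)) ⟩
        ∑[ c < n ] (sum (closedWalk a b c) when (c Fin.≟ a))
          ≈⟨ ∑-select a (λ c → sum (closedWalk a b c)) ⟩
        ∑[ d < n ] closedWalk a b a d
          ≈⟨ sum-cong-≋ (λ d → ≋-trans
               (⊗-cong ≋-refl (⊗-cong (symmetric b a) (⊗-cong ≋-refl (symmetric d a))))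
               (≋-sym (⊗-assoc _ _ _))) ⟩
        ∑[ d < n ] ((M a b * M a b) * (M a d * M a d)) ∎)
      (≋-sym squareOfRowSquares-expand)

    closedWalks-d≡b : ∑⁴ (λ a b c d → closedWalk a b c d when (d Fin.≟ b)) ≈ squareOfRowSquares
    closedWalks-d≡b = ≋-trans
      (sum-cong-≋ λ a → sum-cong-≋ λ b → sum-cong-≋ λ c → ∑-select b (closedWalk a b c))
      -- The walk now goes back and forth at `b`, so the sum over `b` is moved outermost to play the
      -- part of the row index.
      (≋-trans (∑-comm (λ a b → ∑[ c < n ] closedWalk a b c b))
      (≋-trans (sum-cong-≋ λ b → sum-cong-≋ λ a → sum-cong-≋ λ c → ≋-trans
          (⊗-cong (symmetric a b) (⊗-cong ≋-refl (⊗-cong (symmetric c b) ≋-refl)))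
          (solve 2 (λ x y → x ⊙ (y ⊙ (y ⊙ x)) ⊜ (x ⊙ x) ⊙ (y ⊙ y)) ≋-refl (M b a) (M b c)))
        (≋-sym squareOfRowSquares-expand)))

    -- The walk is a-b-a-b-a: a single entry used four times, up to symmetry.
    closedWalks-both :
      ∑⁴ (λ a b c d → (closedWalk a b c d when (c Fin.≟ a)) when (d Fin.≟ b)) ≈ fourthPowers
    closedWalks-both = sum-cong-≋ λ a → sum-cong-≋ λ b → begin
      ∑[ c < n ] ∑[ d < n ] ((closedWalk a b c d when (c Fin.≟ a)) when (d Fin.≟ b))
        ≈⟨ sum-cong-≋ (λ c → ∑-select b (λ d → closedWalk a b c d when (c Fin.≟ a))) ⟩
      ∑[ c < n ] (closedWalk a b c b when (c Fin.≟ a))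
        ≈⟨ ∑-select a (λ c → closedWalk a b c b) ⟩
      closedWalk a b a b
        ≈⟨ ⊗-cong ≋-refl (⊗-cong (symmetric b a) (⊗-cong ≋-refl (symmetric b a))) ⟩
      M a b * (M a b * (M a b * M a b))
        ≈⟨ solve 1 (λ x → x ⊙ (x ⊙ (x ⊙ x)) ⊜ ((x ⊙ x) ⊙ x) ⊙ x) ≋-refl (M a b) ⟩
      M a b * M a b * M a b * M a b ∎

-- The two forms of the functional

tr-^∘2^2 : ∀ {n} (M : Matrix n) → SymmetricMatrix M → tr ((M ^∘2) ^ 2) ≈ fourthPowers M
tr-^∘2^2 {n} M symmetric = sum-cong-≋ {n} λ i → sum-cong-≋ {n} λ j → begin
  (M i j * M i j) * ((M ^∘2) · identity) j i
    ≈⟨ ⊗-cong ≋-refl (·-identityʳ (M ^∘2) j i) ⟩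
  (M i j * M i j) * (M j i * M j i)
    ≈⟨ ⊗-cong ≋-refl (⊗-cong (symmetric j i) (symmetric j i)) ⟩
  (M i j * M i j) * (M i j * M i j)
    ≈⟨ ⊗-assoc _ _ _ ⟨
  M i j * M i j * M i j * M i j ∎

Φ₄≈Φ₄-entries : ∀ {n} (M : Matrix n) → SymmetricMatrix M → Φ₄ M ℚ[w,r].≈ Φ₄-entries M
Φ₄≈Φ₄-entries M symmetric = ⅛·-cong (⊕-cong
  (⊕-cong (≋-refl {p = tr (M ^ 4)}) (⊝-cong (⊗-cong (≋-refl {p = two}) (‖M^∘2·𝟏‖² M))))
  (tr-^∘2^2 M symmetric))

-- Comparison of closed walks with 4-cycles

module _ {n : ℕ} (G : WeightedGraph n) where
  open WeightedGraph G

  private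
    A : Matrix n
    A = adjacencyMatrix G

  -- Adjacent vertices differ by irreflexivity, so with the two given inequalities four edges
  -- already make the vertices distinct and the walk a cycle. If one of the edges is missing, both
  -- sides vanish.
  closedWalk≈cycleTerm : ∀ a b c d → c ≢ a → d ≢ b → closedWalk A a b c d ≈ cycleTerm G a b c d
  closedWalk≈cycleTerm a b c d c≢a d≢b = by-adjacency (adj? a b) (adj? b c) (adj? c d) (adj? d a)
    where
    vs : Vec (Fin n) 4
    vs = a ∷ b ∷ c ∷ d ∷ []

    distinct : ∀ {i j} → Adj i j → i ≢ j
    distinct e i≡j = irrefl i≡j e

    entry : ∀ {i j} → Adj i j → A i j ≈ weight i j
    entry {i} {j} = when-true (adj? i j)

    vanish : ∀ {i j} → ¬ Adj i j → A i j ≈ 0#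
    vanish {i} {j} = when-false (adj? i j)

    by-adjacency : Dec (Adj a b) → Dec (Adj b c) → Dec (Adj c d) → Dec (Adj d a) →
                   closedWalk A a b c d ≈ cycleTerm G a b c d
    by-adjacency (yes ab) (yes bc) (yes cd) (yes da) = ≋-trans
      (⊗-cong (entry ab) (⊗-cong (entry bc) (⊗-cong (entry cd)
        (≋-trans (entry da) (≋-sym (ℤ[w,r].*-identityʳ _))))))
      (≋-sym (when-true (isCycle? G vs)
        ( (distinct ab ∷ ≢-sym c≢a ∷ ≢-sym (distinct da) ∷ []) ∷
          (distinct bc ∷ ≢-sym d≢b ∷ []) ∷ (distinct cd ∷ []) ∷ [] ∷ []
        , ab ∷ bc ∷ cd ∷ da ∷ [] )))
    by-adjacency (no ¬ab) _ _ _ = ≋-trans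
      (≋-trans (⊗-cong (vanish ¬ab) ≋-refl) (ℤ[w,r].zeroˡ _))
      (≋-sym (when-false (isCycle? G vs) λ { (_ , ab ∷ _) → ¬ab ab }))
    by-adjacency _ (no ¬bc) _ _ = ≋-trans
      (≋-trans (⊗-cong ≋-refl (≋-trans (⊗-cong (vanish ¬bc) ≋-refl) (ℤ[w,r].zeroˡ _))) (ℤ[w,r].zeroʳ _))
      (≋-sym (when-false (isCycle? G vs) λ { (_ , _ ∷ bc ∷ _) → ¬bc bc }))
    by-adjacency _ _ (no ¬cd) _ = ≋-trans
      (≋-trans (⊗-cong ≋-refl (≋-trans (⊗-cong ≋-refl
        (≋-trans (⊗-cong (vanish ¬cd) ≋-refl) (ℤ[w,r].zeroˡ _))) (ℤ[w,r].zeroʳ _))) (ℤ[w,r].zeroʳ _))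
      (≋-sym (when-false (isCycle? G vs) λ { (_ , _ ∷ _ ∷ cd ∷ _) → ¬cd cd }))
    by-adjacency _ _ _ (no ¬da) = ≋-trans
      (≋-trans (⊗-cong ≋-refl (≋-trans (⊗-cong ≋-refl
        (≋-trans (⊗-cong ≋-refl (vanish ¬da)) (ℤ[w,r].zeroʳ _))) (ℤ[w,r].zeroʳ _))) (ℤ[w,r].zeroʳ _))
      (≋-sym (when-false (isCycle? G vs) λ { (_ , _ ∷ _ ∷ _ ∷ da ∷ _) → ¬da da }))

  cycleTerm-c≡a : ∀ a b c d → c ≡ a → cycleTerm G a b c d ≈ 0#
  cycleTerm-c≡a a b c d c≡a = when-false (isCycle? G (a ∷ b ∷ c ∷ d ∷ []))
    λ { ((_ ∷ a≢c ∷ _) ∷ _ , _) → a≢c (≡.sym c≡a) }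

  cycleTerm-d≡b : ∀ a b c d → d ≡ b → cycleTerm G a b c d ≈ 0#
  cycleTerm-d≡b a b c d d≡b = when-false (isCycle? G (a ∷ b ∷ c ∷ d ∷ []))
    λ { (_ ∷ (_ ∷ b≢d ∷ _) ∷ _ , _) → b≢d (≡.sym d≡b) }

  closedWalks-inclusion-exclusion :
    tr (A ^ 4) + fourthPowers A ≈
    eight * cyclePolynomial G 4 + (squareOfRowSquares A + squareOfRowSquares A)
  closedWalks-inclusion-exclusion = begin
    tr (A ^ 4) + fourthPowers A
      ≈⟨ ⊕-cong (tr-^4 A) (≋-sym (closedWalks-both A A-symmetric)) ⟩
    ∑⁴ walk + ∑⁴ (λ a b c d → (walk a b c d when (c Fin.≟ a)) when (d Fin.≟ b))
      ≈⟨ ∑⁴-distrib-+ walk (λ a b c d → (walk a b c d when (c Fin.≟ a)) when (d Fin.≟ b)) ⟨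
    ∑⁴ (λ a b c d → walk a b c d + ((walk a b c d when (c Fin.≟ a)) when (d Fin.≟ b)))
      ≈⟨ ∑⁴-cong (λ a b c d → inclusion-exclusion (c Fin.≟ a) (d Fin.≟ b)
           (cycleTerm-c≡a a b c d) (cycleTerm-d≡b a b c d) (closedWalk≈cycleTerm a b c d)) ⟩
    ∑⁴ (λ a b c d → cycleTerm G a b c d + (walk-c≡a a b c d + walk-d≡b a b c d))
      ≈⟨ ∑⁴-distrib-+ (cycleTerm G) (λ a b c d → walk-c≡a a b c d + walk-d≡b a b c d) ⟩
    ∑⁴ (cycleTerm G) + ∑⁴ (λ a b c d → walk-c≡a a b c d + walk-d≡b a b c d)
      ≈⟨ ⊕-cong (≋-sym (eight*cyclePolynomial G)) (∑⁴-distrib-+ walk-c≡a walk-d≡b) ⟩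
    eight * cyclePolynomial G 4 + (∑⁴ walk-c≡a + ∑⁴ walk-d≡b)
      ≈⟨ ⊕-cong ≋-refl (⊕-cong (closedWalks-c≡a A A-symmetric) (closedWalks-d≡b A A-symmetric)) ⟩
    eight * cyclePolynomial G 4 + (squareOfRowSquares A + squareOfRowSquares A) ∎
    where
    A-symmetric = adjacencyMatrix-symmetric G
    walk = closedWalk A
    walk-c≡a walk-d≡b : (a b c d : Fin n) → ℤ[w,r].Carrier
    walk-c≡a a b c d = walk a b c d when (c Fin.≟ a)
    walk-d≡b a b c d = walk a b c d when (d Fin.≟ b)

  -- The identity for eight times the polynomial is proved in ℤ[w,r]; division by 8 is applied to it
  -- as a whole.
  cyclePolynomial≈Φ₄ : ι (cyclePolynomial G 4) ℚ[w,r].≈ Φ₄ A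
  cyclePolynomial≈Φ₄ = ≋-trans (≋-sym (⅛·eight* (cyclePolynomial G 4)))
    (≋-trans (⅛·-cong (begin
      -- Adding and subtracting `two * N` produces `P + (N + N)`, the right side of the
      -- inclusion-exclusion identity, which is then replaced by `T + Q`.
      P                    ≈⟨ ℤ[w,r].+-identityʳ P ⟨
      P + 0#               ≈⟨ ⊕-cong ≋-refl (ℤ[w,r].-‿inverseʳ (two * N)) ⟨
      P + (two * N - two * N)  ≈⟨ ⊕-assoc _ _ _ ⟨
      P + two * N - two * N    ≈⟨ ⊕-cong (⊕-cong ≋-refl two*) ≋-refl ⟩
      P + (N + N) - two * N    ≈⟨ ⊕-cong closedWalks-inclusion-exclusion ≋-refl ⟨
      T + Q - two * N      ≈⟨ ⊕-assoc _ _ _ ⟩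
      T + (Q - two * N)    ≈⟨ ⊕-cong ≋-refl (⊕-comm _ _) ⟩
      T + (- (two * N) + Q)  ≈⟨ ⊕-assoc _ _ _ ⟨
      T - two * N + Q      ∎))
    (≋-sym (Φ₄≈Φ₄-entries A (adjacencyMatrix-symmetric G))))
    where
    P = eight * cyclePolynomial G 4
    N = squareOfRowSquares A
    T = tr (A ^ 4)
    Q = fourthPowers A
    two* : two * N ≈ N + N
    two* = ≋-trans (⊗-cong (con-⊕ (ℤ.+ 1) (ℤ.+ 1)) ≋-refl)
      (≋-trans (ℤ[w,r].distribʳ N 1# 1#) (⊕-cong (⊗-identityˡ N) (⊗-identityˡ N)))

theorem6p2 :
  ((L : Link) → NonSplit L → AlternatingLink L →
   (D : Diagram) → D IsDiagramOf L → Alternating D → (reduced : Reduced D) →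
   (ρ : Rule) (χ : Checkerboard ρ D) →
   ∀ {m n} (νB : Numbering (colouredRegions χ black) m)
           (νW : Numbering (colouredRegions χ white) n) →
   let G*B = consolidatedTaitGraph χ black νB reduced
       G*W = consolidatedTaitGraph χ white νW reduced
       A̅B  = adjacencyMatrix G*B
       A̅W  = adjacencyMatrix G*W
   in (ι (proj₁ (CWR 4 G*B G*W)) ℚ[w,r].≈ Φ₄ A̅B) ×
      (ι (proj₂ (CWR 4 G*B G*W)) ℚ[w,r].≈ Φ₄ A̅W))
  ×
  ((n : ℕ) (M : Matrix n) → SymmetricMatrix M → ZeroDiagonal M →
   Φ₄ M ℚ[w,r].≈ Φ₄-entries M)
theorem6p2 =
  (λ L _ _ D _ _ reduced ρ χ νB νW →
    cyclePolynomial≈Φ₄ (consolidatedTaitGraph χ black νB reduced) ,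
    cyclePolynomial≈Φ₄ (consolidatedTaitGraph χ white νW reduced)) ,
  λ n M symmetric _ → Φ₄≈Φ₄-entries M symmetric
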